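{- Simple $3$-$(20,5,2m)$ designs exist for $m\in\{2,7\}$, i.e. simple $3$-$(20,5,4)$ and $3$-$(20,5,14)$ designs exist.
   Context: A $t$-$(v,k,\lambda)$ design consists of a $v$-element set $P$ of points together with a collection $B$ of $k$-element subsets of $P$ (called blocks) such that every $t$-element subset of $P$ is contained in exactly $\lambda$ blocks. The design is simple if $B$ is a set, i.e. contains no repeated blocks. -}

module Defs where

open import Data.Nat using (ℕ)
open import Data.Fin.Subset using (Subset; ∣_∣; _⊆_)
open import Data.Fin.Subset.Properties using (_⊆?_)
open import Data.List using (List; length; filter)
open import Data.List.Relation.Unary.All using (All)
open import Data.List.Relation.Unary.Unique.Propositional using (Unique)
open import Data.Product using (_×_)
open import Relation.Binary.PropositionalEquality using (_≡_)

countContaining : ∀ {v} → List (Subset v) → Subset v → ℕ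
countContaining B T = length (filter (T ⊆?_) B)

-- A t-(v,k,λ) design on the point set Fin v, blocks given as a list
-- (a multiset) of subsets of Fin v.
IsDesign : (t v k lam : ℕ) → List (Subset v) → Set
IsDesign t v k lam B =
  All (λ b → ∣ b ∣ ≡ k) B ×
  (∀ (T : Subset v) → ∣ T ∣ ≡ t → countContaining B T ≡ lam)

IsSimpleDesign : (t v k lam : ℕ) → List (Subset v) → Set
IsSimpleDesign t v k lam B = IsDesign t v k lam B × Unique B

{-# OPTIONS --safe #-}
module Submission where

-- Both designs are unions of orbits of 5-subsets of ℤ₁₉ ∪ {∞} under the dihedral group of
-- the maps x ↦ ± x + c fixing ∞.  Each is verified by computation, splitting on membership
-- of the first point: the blocks through it form the link, and a t-subset is counted either
-- in the link (if it contains the point) or in the family with the point deleted.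

open import Defs
open import Data.Bool using (Bool; true; false; T; _∧_; if_then_else_)
open import Data.Bool.ListAction using (any; all)
open import Data.Bool.Properties using (T-∧)
open import Data.Fin using (toℕ)
open import Data.Fin.Subset using (Subset; inside; outside; ∣_∣)
open import Data.Fin.Subset.Properties using (_⊆?_)
open import Data.List using (List; []; _∷_; _++_; length; map; concatMap; upTo)
open import Data.List.Properties using (filter-all)
open import Data.List.Relation.Unary.All as All using (All; []; _∷_)
open import Data.List.Relation.Unary.All.Properties using (all⁺)
open import Data.List.Relation.Unary.AllPairs using ([]; _∷_)
open import Data.List.Relation.Unary.Unique.Propositional using (Unique)
open import Data.Nat using (ℕ; zero; suc; _+_; _*_; _∸_; _%_; _≡ᵇ_)
open import Data.Nat.Properties using (≡ᵇ⇒≡; suc-injective)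
open import Data.Product using (Σ; _×_; _,_; proj₁; proj₂)
open import Data.Vec using ([]; _∷_; tail; tabulate)
open import Function using (Equivalence)
open import Relation.Binary.PropositionalEquality using (_≡_; _≢_; refl; trans; cong)
open import Relation.Nullary using (does)

private
  variable
    n : ℕ

link : List (Subset (suc n)) → List (Subset n)
link []                  = []
link ((inside  ∷ b) ∷ B) = b ∷ link B
link ((outside ∷ b) ∷ B) = link B

avoiding : List (Subset (suc n)) → List (Subset n)
avoiding []                  = []
avoiding ((inside  ∷ b) ∷ B) = avoiding B
avoiding ((outside ∷ b) ∷ B) = b ∷ avoiding B

count-[] : (B : List (Subset 0)) → countContaining B [] ≡ length B
count-[] B = cong length (filter-all ([] ⊆?_) (All.universal (λ _ ()) B))

-- A set missing the first point puts no condition there, so blocks through that point count as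
-- well: the tails of all blocks are kept, not only those in `avoiding B`. Tails may coincide, so
-- multiplicity in the list matters.
count-outside : (B : List (Subset (suc n))) (S : Subset n) →
                countContaining B (outside ∷ S) ≡ countContaining (map tail B) S
count-outside []            S = refl
count-outside ((_ ∷ b) ∷ B) S with does (S ⊆? b)
... | true  = cong suc (count-outside B S)
... | false = count-outside B S

count-inside : (B : List (Subset (suc n))) (S : Subset n) →
               countContaining B (inside ∷ S) ≡ countContaining (link B) S
count-inside []                  S = refl
count-inside ((outside ∷ b) ∷ B) S = count-inside B S
count-inside ((inside  ∷ b) ∷ B) S with does (S ⊆? b)
... | true  = cong suc (count-inside B S)
... | false = count-inside B S

-- The recursion follows Pascal's rule, so each `t`-subset of the `n` points corresponds to one leaf
-- with `t` and `n` both zero, where the surviving entries are the blocks containing it. A leaf with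
-- points still to choose but none left is vacuous.
balanced : (t n lam : ℕ) → List (Subset n) → Bool
balanced zero    zero    lam B = length B ≡ᵇ lam
balanced (suc t) zero    lam B = true
balanced zero    (suc n) lam B = balanced zero n lam (map tail B)
balanced (suc t) (suc n) lam B = balanced (suc t) n lam (map tail B) ∧ balanced t n lam (link B)

balanced-sound : ∀ t n lam (B : List (Subset n)) → T (balanced t n lam B) →
                 ∀ S → ∣ S ∣ ≡ t → countContaining B S ≡ lam
balanced-sound zero zero lam B ok [] _ = trans (count-[] B) (≡ᵇ⇒≡ (length B) lam ok)
balanced-sound (suc t) zero lam B ok [] ()
balanced-sound zero (suc n) lam B ok (outside ∷ S) ∣S∣≡0 =
  trans (count-outside B S) (balanced-sound zero n lam (map tail B) ok S ∣S∣≡0)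
balanced-sound (suc t) (suc n) lam B ok (outside ∷ S) ∣S∣≡t =
  trans (count-outside B S) (balanced-sound (suc t) n lam (map tail B)
    (proj₁ (Equivalence.to T-∧ ok)) S ∣S∣≡t)
balanced-sound (suc t) (suc n) lam B ok (inside ∷ S) ∣S∣≡t =
  trans (count-inside B S) (balanced-sound t n lam (link B)
    (proj₂ (Equivalence.to (T-∧ {balanced (suc t) n lam (map tail B)}) ok)) S (suc-injective ∣S∣≡t))

≢-link : ∀ {b : Subset n} B → All (b ≢_) (link B) → All (inside ∷ b ≢_) B
≢-link []                  []         = []
≢-link ((inside  ∷ c) ∷ B) (b≢c ∷ ps) = (λ eq → b≢c (cong tail eq)) ∷ ≢-link B ps
≢-link ((outside ∷ c) ∷ B) ps         = (λ ()) ∷ ≢-link B ps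

≢-avoiding : ∀ {b : Subset n} B → All (b ≢_) (avoiding B) → All (outside ∷ b ≢_) B
≢-avoiding []                  []         = []
≢-avoiding ((inside  ∷ c) ∷ B) ps         = (λ ()) ∷ ≢-avoiding B ps
≢-avoiding ((outside ∷ c) ∷ B) (b≢c ∷ ps) = (λ eq → b≢c (cong tail eq)) ∷ ≢-avoiding B ps

-- Equal blocks agree on the first point, so a repetition would already occur within one of the two
-- classes, where removing that point loses no information.
unique-split : (B : List (Subset (suc n))) → Unique (link B) → Unique (avoiding B) → Unique B
unique-split []                  _        _        = []
unique-split ((inside  ∷ b) ∷ B) (p ∷ ps) qs       = ≢-link B p ∷ unique-split B ps qs
unique-split ((outside ∷ b) ∷ B) ps       (q ∷ qs) = ≢-avoiding B q ∷ unique-split B ps qs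

-- Blocks are sorted into buckets point by point, as in a radix sort. Each final bucket belongs to a
-- single subset and may hold at most one entry.
distinct : (n : ℕ) → List (Subset n) → Bool
distinct zero    []          = true
distinct zero    (_ ∷ [])    = true
distinct zero    (_ ∷ _ ∷ _) = false
distinct (suc n) B           = distinct n (link B) ∧ distinct n (avoiding B)

distinct-sound : ∀ n (B : List (Subset n)) → T (distinct n B) → Unique B
distinct-sound zero    []       _  = []
distinct-sound zero    (_ ∷ []) _  = [] ∷ []
distinct-sound (suc n) B        ok with Equivalence.to (T-∧ {distinct n (link B)}) ok
... | ok-link , ok-avoiding =
  unique-split B (distinct-sound n (link B) ok-link) (distinct-sound n (avoiding B) ok-avoiding)

uniform : (k : ℕ) → List (Subset n) → Bool
uniform k = all (λ b → ∣ b ∣ ≡ᵇ k)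

isSimpleDesign : ∀ t v k lam (B : List (Subset v)) → T (uniform k B) →
                 T (balanced t v lam B) → T (distinct v B) → IsSimpleDesign t v k lam B
isSimpleDesign t v k lam B u b d =
  (All.map (λ {c} → ≡ᵇ⇒≡ ∣ c ∣ k) (all⁺ (λ c → ∣ c ∣ ≡ᵇ k) B u) , balanced-sound t v lam B b) ,
  distinct-sound v B d

-- Points of ℤ₁₉ ∪ {∞} are coded as 0, …, 18 and ∞ = 19.
extend : (ℕ → ℕ) → ℕ → ℕ
extend f x = if x ≡ᵇ 19 then 19 else f x % 19

translate : ℕ → List ℕ → List ℕ
translate c = map (extend (_+ c))

-- For the point 0, `19 ∸ 0` is reduced modulo 19 back to 0, so it is not mistaken for ∞.
negate : List ℕ → List ℕ
negate = map (extend (19 ∸_))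

toSubset : List ℕ → Subset 20
toSubset xs = tabulate (λ i → any (toℕ i ≡ᵇ_) xs)

-- The first argument lists representatives of the dihedral orbits that are single ℤ₁₉-orbits,
-- the second those of the orbits of length 38.
dihedralOrbits : List (List ℕ) → List (List ℕ) → List (Subset 20)
dihedralOrbits short long =
  concatMap (λ b → map (λ c → toSubset (translate c b)) (upTo 19))
            -- Negation exchanges the two translation orbits in a dihedral orbit of length 38. As 19
            -- is prime, no 5-subset is fixed by a nonzero translation, so each representative
            -- yields 19 blocks.
            (short ++ long ++ map negate long)

blocks₄ : List (Subset 20)
blocks₄ = dihedralOrbits
  ( (0 ∷ 1 ∷ 2 ∷ 4 ∷ 17 ∷ []) ∷ (0 ∷ 1 ∷ 2 ∷ 5 ∷ 16 ∷ []) ∷ (0 ∷ 1 ∷ 3 ∷ 5 ∷ 6 ∷ [])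
    ∷ (0 ∷ 1 ∷ 5 ∷ 10 ∷ 15 ∷ []) ∷ (0 ∷ 1 ∷ 6 ∷ 10 ∷ 14 ∷ []) ∷ (0 ∷ 2 ∷ 4 ∷ 7 ∷ 16 ∷ [])
    ∷ []
  )
  ( (0 ∷ 1 ∷ 2 ∷ 8 ∷ 11 ∷ []) ∷ (0 ∷ 1 ∷ 3 ∷ 11 ∷ 13 ∷ []) ∷ (0 ∷ 1 ∷ 3 ∷ 12 ∷ 16 ∷ [])
    ∷ (0 ∷ 1 ∷ 4 ∷ 11 ∷ 19 ∷ []) ∷ (0 ∷ 1 ∷ 5 ∷ 8 ∷ 13 ∷ []) ∷ (0 ∷ 1 ∷ 6 ∷ 8 ∷ 19 ∷ [])
    ∷ (0 ∷ 1 ∷ 6 ∷ 9 ∷ 13 ∷ []) ∷ (0 ∷ 2 ∷ 5 ∷ 15 ∷ 19 ∷ []) ∷ (0 ∷ 2 ∷ 6 ∷ 12 ∷ 14 ∷ [])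
    ∷ []
  )

blocks₁₄ : List (Subset 20)
blocks₁₄ = dihedralOrbits
  ( (0 ∷ 1 ∷ 2 ∷ 3 ∷ 19 ∷ []) ∷ (0 ∷ 1 ∷ 3 ∷ 4 ∷ 19 ∷ []) ∷ (0 ∷ 1 ∷ 4 ∷ 7 ∷ 8 ∷ [])
    ∷ (0 ∷ 1 ∷ 4 ∷ 10 ∷ 16 ∷ []) ∷ (0 ∷ 1 ∷ 6 ∷ 7 ∷ 13 ∷ []) ∷ (0 ∷ 1 ∷ 6 ∷ 10 ∷ 14 ∷ [])
    ∷ (0 ∷ 1 ∷ 6 ∷ 14 ∷ 19 ∷ []) ∷ (0 ∷ 2 ∷ 9 ∷ 11 ∷ 19 ∷ []) ∷ (0 ∷ 2 ∷ 9 ∷ 12 ∷ 19 ∷ [])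
    ∷ (0 ∷ 3 ∷ 6 ∷ 9 ∷ 19 ∷ []) ∷ (0 ∷ 3 ∷ 6 ∷ 10 ∷ 15 ∷ []) ∷ (0 ∷ 3 ∷ 7 ∷ 10 ∷ 19 ∷ [])
    ∷ (0 ∷ 3 ∷ 9 ∷ 13 ∷ 19 ∷ []) ∷ (0 ∷ 4 ∷ 8 ∷ 12 ∷ 19 ∷ [])
    ∷ []
  )
  ( (0 ∷ 1 ∷ 2 ∷ 4 ∷ 11 ∷ []) ∷ (0 ∷ 1 ∷ 2 ∷ 4 ∷ 14 ∷ []) ∷ (0 ∷ 1 ∷ 2 ∷ 6 ∷ 10 ∷ [])
    ∷ (0 ∷ 1 ∷ 2 ∷ 6 ∷ 11 ∷ []) ∷ (0 ∷ 1 ∷ 2 ∷ 6 ∷ 13 ∷ []) ∷ (0 ∷ 1 ∷ 2 ∷ 7 ∷ 11 ∷ [])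
    ∷ (0 ∷ 1 ∷ 3 ∷ 4 ∷ 7 ∷ []) ∷ (0 ∷ 1 ∷ 3 ∷ 5 ∷ 9 ∷ []) ∷ (0 ∷ 1 ∷ 3 ∷ 5 ∷ 19 ∷ [])
    ∷ (0 ∷ 1 ∷ 3 ∷ 6 ∷ 8 ∷ []) ∷ (0 ∷ 1 ∷ 3 ∷ 8 ∷ 17 ∷ []) ∷ (0 ∷ 1 ∷ 3 ∷ 9 ∷ 12 ∷ [])
    ∷ (0 ∷ 1 ∷ 3 ∷ 11 ∷ 16 ∷ []) ∷ (0 ∷ 1 ∷ 3 ∷ 14 ∷ 15 ∷ []) ∷ (0 ∷ 1 ∷ 4 ∷ 7 ∷ 10 ∷ [])
    ∷ (0 ∷ 1 ∷ 4 ∷ 8 ∷ 9 ∷ []) ∷ (0 ∷ 1 ∷ 4 ∷ 10 ∷ 14 ∷ []) ∷ (0 ∷ 1 ∷ 4 ∷ 11 ∷ 13 ∷ [])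
    ∷ (0 ∷ 1 ∷ 4 ∷ 12 ∷ 15 ∷ []) ∷ (0 ∷ 1 ∷ 5 ∷ 7 ∷ 15 ∷ []) ∷ (0 ∷ 1 ∷ 5 ∷ 8 ∷ 13 ∷ [])
    ∷ (0 ∷ 1 ∷ 5 ∷ 11 ∷ 19 ∷ []) ∷ (0 ∷ 1 ∷ 5 ∷ 12 ∷ 19 ∷ []) ∷ (0 ∷ 1 ∷ 6 ∷ 8 ∷ 11 ∷ [])
    ∷ (0 ∷ 1 ∷ 6 ∷ 12 ∷ 19 ∷ []) ∷ (0 ∷ 1 ∷ 7 ∷ 9 ∷ 12 ∷ []) ∷ (0 ∷ 1 ∷ 7 ∷ 9 ∷ 13 ∷ [])
    ∷ (0 ∷ 2 ∷ 4 ∷ 6 ∷ 9 ∷ []) ∷ (0 ∷ 2 ∷ 4 ∷ 8 ∷ 11 ∷ []) ∷ (0 ∷ 2 ∷ 5 ∷ 7 ∷ 10 ∷ [])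
    ∷ (0 ∷ 2 ∷ 5 ∷ 10 ∷ 12 ∷ []) ∷ (0 ∷ 2 ∷ 5 ∷ 10 ∷ 19 ∷ []) ∷ (0 ∷ 2 ∷ 6 ∷ 8 ∷ 13 ∷ [])
    ∷ (0 ∷ 2 ∷ 6 ∷ 9 ∷ 14 ∷ []) ∷ (0 ∷ 2 ∷ 8 ∷ 12 ∷ 19 ∷ [])
    ∷ []
  )

theorem3 : Σ (List (Subset 20)) (λ B → IsSimpleDesign 3 20 5 (2 * 2) B)
    × Σ (List (Subset 20)) (λ B → IsSimpleDesign 3 20 5 (2 * 7) B)
-- Each Boolean check evaluates to `true`, which turns its `T` type into the unit type and lets the
-- underscores be solved. The families have 24 · 19 = 456 and 84 · 19 = 1596 blocks, matching λ ·
-- 1140 / 10.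
theorem3 = (blocks₄ , isSimpleDesign 3 20 5 4 blocks₄ _ _ _) ,
           (blocks₁₄ , isSimpleDesign 3 20 5 14 blocks₁₄ _ _ _)
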